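{- Let $S={a_1 \choose b_1},\dots,{a_n \choose b_n}$ be a canonically sorted sequence (of tuples of nonnegative integers, with no zero tuple and with $\sum_{i=1}^n a_i=\sum_{i=1}^n b_i$) such that $\sum_{i=1}^{n}a_i\leq n-1$, containing exactly $k>0$ source tuples, and such that $S$ is not a source-sink-sequence. Let ${a_i \choose b_i}$ be an arbitrary stream tuple of $S$ with $a_i\leq k$. Let $$S':={0 \choose b_1-1},\dots,{0 \choose b_{a_{i}}-1},{0 \choose b_{a_{i}+1}},\dots,{0 \choose b_k},\dots,{a_{i-1} \choose b_{i-1}},{0 \choose b_{i}},{a_{i+1} \choose b_{i+1}},\dots,{a_n \choose b_n},$$ i.e. $S'$ arises from $S$ by subtracting $1$ from the second entry of each of the first $a_i$ (source) tuples, replacing the first entry of the $i$-th tuple by $0$, and leaving all other tuples unchanged. Then $S$ is a dag sequence if and only if $S'$ is a dag sequence.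
   Context: A sequence $S={a_1 \choose b_1},\dots,{a_n \choose b_n}$ with $a_i,b_i\in\mathbb{Z}_{\ge 0}$ is a dag sequence if there is an acyclic digraph $G=(V,A)$ without parallel arcs (a dag) with labeled vertex set $V=\{v_1,\dots,v_n\}$ such that $v_i$ has indegree $a_i$ and outdegree $b_i$ for all $i$ (the empty sequence is a dag sequence). A tuple ${a \choose b}$ is a zero tuple if $a=b=0$, a source tuple if $a=0,b>0$, a sink tuple if $a>0,b=0$, and a stream tuple if $a>0,b>0$. A source-sink-sequence is a sequence consisting only of source and sink tuples. A sequence with $q$ source tuples and $s$ sink tuples is canonically sorted if its first $q$ tuples are the source tuples, sorted decreasingly (i.e. non-increasingly) by $b_i$, and its last $s$ tuples are the sink tuples, sorted increasingly (i.e. non-decreasingly) by $a_i$. The sequence $S'$ may contain zero tuples; these are then deleted (which corresponds to removing isolated vertices and does not affect whether the sequence is a dag sequence). -}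

module Defs where

import Algebra.Properties.CommutativeMonoid.Sum
open import Data.Bool using (Bool; T; if_then_else_)
open import Data.Fin as Fin using (Fin; toℕ)
open import Data.Nat using (ℕ; _≤_; _<_; _>_; _∸_; _≟_; _<?_; _>?_)
open import Data.Nat.Properties using (+-0-commutativeMonoid)
open import Data.Product using (Σ; _×_)
open import Data.Sum using (_⊎_)
open import Data.Vec.Functional using (Vector)
open import Relation.Binary.Construct.Closure.Transitive using (TransClosure)
open import Relation.Binary.PropositionalEquality using (_≡_)
open import Relation.Nullary using (¬_; Dec; does)
open import Relation.Nullary.Decidable using (_×-dec_)

open Algebra.Properties.CommutativeMonoid.Sum +-0-commutativeMonoid public using (sum)

# : ∀ {n} → (Fin n → Bool) → ℕ
# p = sum (λ j → if p j then 1 else 0)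

-- A Boolean adjacency matrix on the labelled vertices Fin n: parallel arcs
-- cannot occur, and loops are ruled out by acyclicity.

Digraph : ℕ → Set
Digraph n = Fin n → Fin n → Bool

module _ {n : ℕ} (G : Digraph n) where

  Arc : Fin n → Fin n → Set
  Arc u v = T (G u v)

  indegree : Fin n → ℕ
  indegree v = # (λ u → G u v)

  outdegree : Fin n → ℕ
  outdegree v = # (λ w → G v w)

  Acyclic : Set
  Acyclic = ∀ v → ¬ TransClosure Arc v v

record Tuple : Set where
  constructor ⟨_,_⟩
  field
    a : ℕ
    b : ℕ

open Tuple public

IsZero IsSource IsSink IsStream : Tuple → Set
IsZero   t = a t ≡ 0 × b t ≡ 0
IsSource t = a t ≡ 0 × b t > 0
IsSink   t = a t > 0 × b t ≡ 0
IsStream t = a t > 0 × b t > 0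

isSource? : ∀ t → Dec (IsSource t)
isSource? t = (a t ≟ 0) ×-dec (b t >? 0)

isSink? : ∀ t → Dec (IsSink t)
isSink? t = (a t >? 0) ×-dec (b t ≟ 0)

Sequence : ℕ → Set
Sequence n = Vector Tuple n

IsDagSequence : ∀ {n} → Sequence n → Set
IsDagSequence {n} S =
  Σ (Digraph n) λ G →
    Acyclic G × (∀ v → indegree G v ≡ a (S v) × outdegree G v ≡ b (S v))

#sources : ∀ {n} → Sequence n → ℕ
#sources S = # (λ j → does (isSource? (S j)))

#sinks : ∀ {n} → Sequence n → ℕ
#sinks S = # (λ j → does (isSink? (S j)))

IsSourceSinkSequence : ∀ {n} → Sequence n → Set
IsSourceSinkSequence S = ∀ j → IsSource (S j) ⊎ IsSink (S j)

-- Positions are 0-based: the first q are those with toℕ j < q, the last s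
-- those with n ∸ s ≤ toℕ j.

record CanonicallySorted {n : ℕ} (S : Sequence n) : Set where
  q = #sources S
  s = #sinks S
  field
    sources-first      : ∀ j → toℕ j < q → IsSource (S j)
    sources-decreasing : ∀ j l → j Fin.≤ l → toℕ l < q → b (S l) ≤ b (S j)
    sinks-last         : ∀ j → n ∸ s ≤ toℕ j → IsSink (S j)
    sinks-increasing   : ∀ j l → n ∸ s ≤ toℕ j → j Fin.≤ l → a (S j) ≤ a (S l)

-- The sequence S′ obtained from S at position i.  Tuples that become zero
-- are kept, as in the displayed sequence of length n.

reduce : ∀ {n} → Sequence n → Fin n → Sequence n
reduce S i j =
  ⟨ (if does (j Fin.≟ i) then 0 else a (S j))
  , (if does (toℕ j <? a (S i)) then b (S j) ∸ 1 else b (S j))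
  ⟩

{-# OPTIONS --safe #-}
module Submission where

-- Every sequence of n nonzero tuples with Σ a = Σ b < n is a dag sequence, in
-- fact realized by a forest: as long as some vertex has total degree at least 2,
-- a vertex of total degree 1 can be removed together with its arc to such a
-- vertex, which lowers the number of arcs and the number of nonzero tuples by 1
-- each; once all total degrees are at most 1, a matching realizes what is left.
-- Passing from S to S′ removes a i arcs and creates at most a i zero tuples, so
-- S′ satisfies the same inequality, and both S and S′ are dag sequences.

open import Defs
open import Data.Bool using (Bool; true; false; T; if_then_else_; _∧_; _∨_)
open import Data.Bool.Properties using (T-∨; T-∧)
open import Data.Fin as Fin using (Fin; zero; suc; toℕ)
open import Data.Fin.Properties using (any?)
open import Data.Nat using (ℕ; zero; suc; _+_; _*_; _⊓_; _≤_; _<_; _>_; _∸_; _≤?_; _<?_; z≤n; s≤s; s≤s⁻¹; z<s)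
open import Data.Nat.Properties
open import Algebra.Properties.CommutativeMonoid.Sum +-0-commutativeMonoid using (sum-cong-≗; sum-replicate-zero; ∑-distrib-+)
open import Data.Product using (∃; _×_; _,_; proj₁; proj₂)
open import Data.Sum using (_⊎_; inj₁; inj₂)
open import Function using (_∘_; flip; const)
open import Function.Bundles using (_⇔_; mk⇔; Equivalence)
open import Relation.Binary.Construct.Closure.Transitive using (TransClosure; [_]; _∷_; _∷ʳ_)
open import Relation.Binary.PropositionalEquality using (_≡_; _≢_; refl; sym; trans; cong; cong₂; subst; subst₂; module ≡-Reasoning)
open import Relation.Nullary using (¬_; Dec; yes; no; does; contradiction)
open import Relation.Nullary.Decidable using (dec-true; dec-false)

private
  variable
    n : ℕ

-- Finite sums

-- If the head of `f` is not the smaller one, cancelling it leaves a strict inequality between the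
-- tails.
sum-<⇒∃ : (f g : Fin n → ℕ) → sum f < sum g → ∃ λ j → f j < g j
sum-<⇒∃ {suc n} f g lt with f zero <? g zero
... | yes f₀<g₀ = zero , f₀<g₀
... | no  f₀≮g₀ with sum-<⇒∃ (f ∘ suc) (g ∘ suc)
                       (+-cancelˡ-< (f zero) _ _ (<-≤-trans lt (+-monoˡ-≤ _ (≮⇒≥ f₀≮g₀))))
...   | j , fj<gj = suc j , fj<gj

sum-mono-≤ : {f g : Fin n → ℕ} → (∀ j → f j ≤ g j) → sum f ≤ sum g
sum-mono-≤ {f = f} {g} f≤g = ≮⇒≥ λ lt → let j , gj<fj = sum-<⇒∃ g f lt in <⇒≱ gj<fj (f≤g j)

sum-const-1 : ∀ n → sum {n} (const 1) ≡ n
sum-const-1 zero    = refl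
sum-const-1 (suc n) = cong suc (sum-const-1 n)

sum>0⇒∃ : (f : Fin n → ℕ) → sum f > 0 → ∃ λ j → f j > 0
sum>0⇒∃ {n} f pos = sum-<⇒∃ (const 0) f (subst (_< sum f) (sym (sum-replicate-zero n)) pos)

sum≡0⇒≡0 : (f : Fin n → ℕ) → sum f ≡ 0 → ∀ j → f j ≡ 0
sum≡0⇒≡0 f eq zero    = m+n≡0⇒m≡0 (f zero) eq
sum≡0⇒≡0 f eq (suc j) = sum≡0⇒≡0 (f ∘ suc) (m+n≡0⇒n≡0 (f zero) eq) j

⟦_⟧ : Bool → ℕ
⟦ p ⟧ = if p then 1 else 0

⟦⟧≤1 : ∀ p → ⟦ p ⟧ ≤ 1
⟦⟧≤1 false = z≤n
⟦⟧≤1 true  = ≤-refl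

⟦⟧≡0⇒¬T : ∀ {p} → ⟦ p ⟧ ≡ 0 → ¬ T p
⟦⟧≡0⇒¬T {false} _ ()

does⇒ : ∀ {P : Set} (P? : Dec P) → T (does P?) → P
does⇒ (yes p) _ = p

-- The hypothesis makes the disjuncts exclusive, so their indicators add up; the product is the form
-- that `sum-δ*` collapses.
⟦∨∧⟧ : ∀ p q r → (T q → ¬ T p) → ⟦ p ∨ (q ∧ r) ⟧ ≡ ⟦ p ⟧ + ⟦ q ⟧ * ⟦ r ⟧
⟦∨∧⟧ false false r     _ = refl
⟦∨∧⟧ false true  false _ = refl
⟦∨∧⟧ false true  true  _ = refl
⟦∨∧⟧ true  false r     _ = refl
⟦∨∧⟧ true  true  r     ¬p = contradiction _ (¬p _)

#≤n : (p : Fin n → Bool) → # p ≤ n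
#≤n {n} p = ≤-trans (sum-mono-≤ (⟦⟧≤1 ∘ p)) (≤-reflexive (sum-const-1 n))

#-initial : ∀ {c} → c ≤ n → # {n} (λ j → does (toℕ j <? c)) ≡ c
#-initial {n} z≤n     = sum-replicate-zero n
#-initial (s≤s c≤n) = cong suc (#-initial c≤n)

-- The Kronecker delta.
δ : Fin n → Fin n → ℕ
δ v j = ⟦ does (j Fin.≟ v) ⟧

δ-self : (v : Fin n) → δ v v ≡ 1
δ-self v = cong ⟦_⟧ (dec-true (v Fin.≟ v) refl)

δ-other : {v j : Fin n} → j ≢ v → δ v j ≡ 0
δ-other {v = v} {j} j≢v = cong ⟦_⟧ (dec-false (j Fin.≟ v) j≢v)

sum-δ* : ∀ (v : Fin n) c → sum (λ j → δ v j * c) ≡ c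
sum-δ* {suc n} zero    c = trans (cong₂ _+_ (*-identityˡ c) (sum-replicate-zero n)) (+-identityʳ c)
-- The head term computes to 0, and `suc j ≟ suc v` has the same truth value as `j ≟ v` by
-- computation.
sum-δ* {suc n} (suc v) c = sum-δ* v c

sum-δ : (v : Fin n) → sum (δ v) ≡ 1
sum-δ v = trans (sum-cong-≗ (λ j → sym (*-identityʳ (δ v j)))) (sum-δ* v 1)

lower : (f : Fin n → ℕ) → Fin n → Fin n → ℕ
lower f v j = f j ∸ δ v j

lower-+δ : (f : Fin n → ℕ) {v : Fin n} → f v > 0 → ∀ j → lower f v j + δ v j ≡ f j
lower-+δ f {v} fv>0 j = m∸n+n≡m (δ≤f (j Fin.≟ v))
  where
  δ≤f : Dec (j ≡ v) → δ v j ≤ f j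
  δ≤f (yes refl) = subst (_≤ f j) (sym (δ-self v)) fv>0
  δ≤f (no j≢v)   = subst (_≤ f j) (sym (δ-other j≢v)) z≤n

sum-lower : ∀ (f : Fin n → ℕ) {v m} → f v > 0 → sum f ≡ suc m → sum (lower f v) ≡ m
sum-lower f {v} {m} fv>0 Σf = suc-injective (begin
  suc (sum (lower f v))            ≡⟨ +-comm 1 _ ⟩
  sum (lower f v) + 1              ≡⟨ cong (sum (lower f v) +_) (sym (sum-δ v)) ⟩
  sum (lower f v) + sum (δ v)      ≡⟨ sym (∑-distrib-+ (lower f v) (δ v)) ⟩
  sum (λ j → lower f v j + δ v j)  ≡⟨ sum-cong-≗ (lower-+δ f fv>0) ⟩
  sum f                            ≡⟨ Σf ⟩
  suc m                            ∎)
  where open ≡-Reasoning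

-- Operations on sequences

swap : Sequence n → Sequence n
swap S j = ⟨ b (S j) , a (S j) ⟩

-- Reversing all arcs exchanges in- and outdegrees and turns cycles into cycles.
swap-dag : {S : Sequence n} → IsDagSequence (swap S) → IsDagSequence S
swap-dag (G , acyclic , degrees) =
  flip G , (λ v → acyclic v ∘ reverse) , λ v → proj₂ (degrees v) , proj₁ (degrees v)
  where
  reverse : ∀ {x y} → TransClosure (Arc (flip G)) x y → TransClosure (Arc G) y x
  reverse [ e ]   = [ e ]
  reverse (e ∷ p) = reverse p ∷ʳ e

removeArc : Sequence n → Fin n → Fin n → Sequence n
removeArc S u v j = ⟨ lower (a ∘ S) v j , lower (b ∘ S) u j ⟩

-- Acyclicity survives because no arc of the extended graph enters u.
addArc : (S : Sequence n) {u v : Fin n} → a (S u) ≡ 0 → b (S u) ≡ 1 → a (S v) > 0 →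
         IsDagSequence (removeArc S u v) → IsDagSequence S
addArc {n} S {u} {v} au≡0 bu≡1 av>0 (G , acyclic , degrees) =
  G⁺ , acyclic⁺ , λ w → indegree⁺ w , outdegree⁺ w
  where
  open ≡-Reasoning

  G⁺ : Digraph n
  G⁺ x y = G x y ∨ (does (x Fin.≟ u) ∧ does (y Fin.≟ v))

  v≢u : v ≢ u
  v≢u refl = n>0⇒n≢0 av>0 au≡0

  no-arc-into-u : ∀ x → ¬ Arc G x u
  no-arc-into-u x = ⟦⟧≡0⇒¬T (sum≡0⇒≡0 _ (trans (proj₁ (degrees u))
    (trans (cong (_∸ δ v u) au≡0) (0∸n≡0 (δ v u)))) x)

  -- The single outgoing arc of `u` is the one still to be added, so it cannot be parallel to an arc
  -- of `G`.
  no-arc-from-u : ∀ y → ¬ Arc G u y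
  no-arc-from-u y = ⟦⟧≡0⇒¬T (sum≡0⇒≡0 _ (trans (proj₂ (degrees u))
    (cong₂ _∸_ bu≡1 (δ-self u))) y)

  ⟦G⁺⟧ : ∀ x y → ⟦ G⁺ x y ⟧ ≡ ⟦ G x y ⟧ + δ u x * δ v y
  ⟦G⁺⟧ x y = ⟦∨∧⟧ (G x y) _ _ λ x≡u →
    subst (λ w → ¬ Arc G w y) (sym (does⇒ (x Fin.≟ u) x≡u)) (no-arc-from-u y)

  indegree⁺ : ∀ w → indegree G⁺ w ≡ a (S w)
  indegree⁺ w = begin
    indegree G⁺ w                            ≡⟨ sum-cong-≗ (λ x → ⟦G⁺⟧ x w) ⟩
    sum (λ x → ⟦ G x w ⟧ + δ u x * δ v w)    ≡⟨ ∑-distrib-+ (λ x → ⟦ G x w ⟧) _ ⟩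
    indegree G w + sum (λ x → δ u x * δ v w) ≡⟨ cong₂ _+_ (proj₁ (degrees w)) (sum-δ* u (δ v w)) ⟩
    lower (a ∘ S) v w + δ v w                ≡⟨ lower-+δ (a ∘ S) av>0 w ⟩
    a (S w)                                  ∎

  outdegree⁺ : ∀ w → outdegree G⁺ w ≡ b (S w)
  outdegree⁺ w = begin
    outdegree G⁺ w
      ≡⟨ sum-cong-≗ (λ y → trans (⟦G⁺⟧ w y) (cong (⟦ G w y ⟧ +_) (*-comm (δ u w) (δ v y)))) ⟩
    sum (λ y → ⟦ G w y ⟧ + δ v y * δ u w)     ≡⟨ ∑-distrib-+ (λ y → ⟦ G w y ⟧) _ ⟩
    outdegree G w + sum (λ y → δ v y * δ u w) ≡⟨ cong₂ _+_ (proj₂ (degrees w)) (sum-δ* v (δ u w)) ⟩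
    lower (b ∘ S) u w + δ u w                 ≡⟨ lower-+δ (b ∘ S) (subst (0 <_) (sym bu≡1) z<s) w ⟩
    b (S w)                                   ∎

  arc⁻ : ∀ {x y} → Arc G⁺ x y → Arc G x y ⊎ (x ≡ u × y ≡ v)
  arc⁻ {x} {y} e with Equivalence.to (T-∨ {G x y}) e
  ... | inj₁ old = inj₁ old
  ... | inj₂ new = let x≡u , y≡v = Equivalence.to (T-∧ {does (x Fin.≟ u)}) new
                   in inj₂ (does⇒ (x Fin.≟ u) x≡u , does⇒ (y Fin.≟ v) y≡v)

  target≢u : ∀ {x y} → Arc G⁺ x y → y ≢ u
  target≢u {x} e refl with arc⁻ e
  ... | inj₁ old       = no-arc-into-u x old
  ... | inj₂ (_ , u≡v) = v≢u (sym u≡v)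

  oldArc : ∀ {x y} → x ≢ u → Arc G⁺ x y → Arc G x y
  oldArc x≢u e with arc⁻ e
  ... | inj₁ old       = old
  ... | inj₂ (x≡u , _) = contradiction x≡u x≢u

  oldPath : ∀ {x y} → x ≢ u → TransClosure (Arc G⁺) x y → TransClosure (Arc G) x y
  oldPath x≢u [ e ]   = [ oldArc x≢u e ]
  oldPath x≢u (e ∷ p) = oldArc x≢u e ∷ oldPath (target≢u e) p

  endpoint≢u : ∀ {x y} → TransClosure (Arc G⁺) x y → y ≢ u
  endpoint≢u [ e ]   = target≢u e
  endpoint≢u (e ∷ p) = endpoint≢u p

  acyclic⁺ : Acyclic G⁺
  -- A closed path also ends at its start `w`, so `w ≢ u` and all its arcs are old.
  acyclic⁺ w p = acyclic w (oldPath (endpoint≢u p) p)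

-- Realizability of sparse sequences

degree : Tuple → ℕ
degree t = a t + b t

nonzero : Tuple → ℕ
nonzero t = 1 ⊓ degree t

#nonzero : Sequence n → ℕ
#nonzero S = sum (nonzero ∘ S)

nonzero≡1 : ∀ {t} → degree t > 0 → nonzero t ≡ 1
nonzero≡1 = m≤n⇒m⊓n≡m

#nonzero-swap : (S : Sequence n) → #nonzero S ≡ #nonzero (swap S)
#nonzero-swap S = sum-cong-≗ λ j → cong (1 ⊓_) (+-comm (a (S j)) (b (S j)))

-- Here `m` is the number of arcs. The second alternative serves the matching phase, where each
-- removal creates two zero tuples and the strict inequality is lost at `m = 0`.
Sparse : ℕ → Sequence n → Set
Sparse m S = sum (a ∘ S) ≡ m × sum (b ∘ S) ≡ m
           × (m < #nonzero S ⊎ (∀ j → degree (S j) ≤ 1))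

-- The degrees add up to `2m`, which is less than twice the number of nonzero tuples; so some
-- nonzero tuple has degree below 2.
∃-degree-1 : ∀ {m} (S : Sequence n) → sum (a ∘ S) ≡ m → sum (b ∘ S) ≡ m → m < #nonzero S →
             ∃ λ j → degree (S j) ≡ 1
∃-degree-1 {m = m} S Σa Σb m<N =
  let j , lt = sum-<⇒∃ (degree ∘ S) (λ j → nonzero (S j) + nonzero (S j))
                 (subst₂ _<_ (sym (trans (∑-distrib-+ (a ∘ S) (b ∘ S)) (cong₂ _+_ Σa Σb)))
                   (sym (∑-distrib-+ (nonzero ∘ S) (nonzero ∘ S))) (+-mono-< m<N m<N))
  in j , degree≡1 _ lt
  where
  degree≡1 : ∀ d → d < (1 ⊓ d) + (1 ⊓ d) → d ≡ 1
  degree≡1 1 _ = refl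
  degree≡1 (suc (suc d)) (s≤s (s≤s ()))

-- The tuple at u becomes zero, while the one at v, losing one arc, does not.
#nonzero-removeArc : (S : Sequence n) {u v : Fin n} → 2 ≤ degree (S v) →
                     #nonzero S ≤ #nonzero (removeArc S u v) + 1
#nonzero-removeArc {n} S {u} {v} 2≤dv =
  subst (#nonzero S ≤_)
    (trans (∑-distrib-+ (nonzero ∘ S′) (δ u)) (cong (#nonzero S′ +_) (sum-δ u)))
    (sum-mono-≤ λ j → bound j (j Fin.≟ u) (j Fin.≟ v))
  where
  open ≤-Reasoning
  S′ = removeArc S u v

  bound : ∀ j → Dec (j ≡ u) → Dec (j ≡ v) → nonzero (S j) ≤ nonzero (S′ j) + δ u j
  bound j (yes refl) _ = begin
    nonzero (S j)              ≤⟨ m⊓n≤m 1 _ ⟩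
    1                          ≡⟨ δ-self u ⟨
    δ u j                      ≤⟨ m≤n+m _ _ ⟩
    nonzero (S′ j) + δ u j     ∎
  bound j (no j≢u) (yes refl) = begin
    nonzero (S j)              ≤⟨ m⊓n≤m 1 _ ⟩
    1                          ≡⟨ m≤n⇒m⊓n≡m (positive (a (S j)) (b (S j)) 2≤dv) ⟨
    1 ⊓ ((a (S j) ∸ 1) + (b (S j) ∸ 0))
      ≡⟨ cong₂ (λ x y → 1 ⊓ ((a (S j) ∸ x) + (b (S j) ∸ y))) (δ-self v) (δ-other j≢u) ⟨
    nonzero (S′ j)             ≤⟨ m≤m+n _ _ ⟩
    nonzero (S′ j) + δ u j     ∎
    where
    positive : ∀ x y → 2 ≤ x + y → 0 < (x ∸ 1) + y
    positive zero    y 2≤y       = <⇒≤ 2≤y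
    positive (suc x) y (s≤s 1≤d) = 1≤d
  bound j (no j≢u) (no j≢v) = begin
    nonzero (S j)
      ≡⟨ cong₂ (λ x y → 1 ⊓ ((a (S j) ∸ x) + (b (S j) ∸ y))) (δ-other j≢v) (δ-other j≢u) ⟨
    nonzero (S′ j)             ≤⟨ m≤m+n _ _ ⟩
    nonzero (S′ j) + δ u j     ∎

-- Induction step from `m` to `suc m` arcs, with `realize` as induction hypothesis

module _ {n m : ℕ} (realize : (S : Sequence n) → Sparse m S → IsDagSequence S) where

  dag-by-addArc : (S : Sequence n) {u v : Fin n} → a (S u) ≡ 0 → b (S u) ≡ 1 → a (S v) > 0 →
                  sum (a ∘ S) ≡ suc m → sum (b ∘ S) ≡ suc m →
                  m < #nonzero (removeArc S u v) ⊎ (∀ j → degree (removeArc S u v j) ≤ 1) →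
                  IsDagSequence S
  dag-by-addArc S au≡0 bu≡1 av>0 Σa Σb sparse = addArc S au≡0 bu≡1 av>0 (realize _
    ( sum-lower (a ∘ S) av>0 Σa
    , sum-lower (b ∘ S) (subst (0 <_) (sym bu≡1) z<s) Σb
    , sparse ))

  -- The arc count drops by one and the number of nonzero tuples by at most one, so the strict
  -- inequality survives.
  dag-by-leaf : (S : Sequence n) {u v : Fin n} → a (S u) ≡ 0 → b (S u) ≡ 1 →
                a (S v) > 0 → 2 ≤ degree (S v) →
                sum (a ∘ S) ≡ suc m → sum (b ∘ S) ≡ suc m → suc m < #nonzero S → IsDagSequence S
  dag-by-leaf S {u} {v} au≡0 bu≡1 av>0 2≤dv Σa Σb m<N = dag-by-addArc S au≡0 bu≡1 av>0 Σa Σb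
    (inj₁ (s≤s⁻¹ (subst (suc m <_) (+-comm _ 1) (<-≤-trans m<N (#nonzero-removeArc S {u} {v} 2≤dv)))))

  -- Any vertex with `b > 0` then has `a = 0` and `b = 1`, so it can be joined to any vertex with
  -- `a > 0`; removing the arc keeps the degree bound.
  dag-by-matching : (S : Sequence n) → (∀ j → degree (S j) ≤ 1) →
                    sum (a ∘ S) ≡ suc m → sum (b ∘ S) ≡ suc m → IsDagSequence S
  dag-by-matching S d≤1 Σa Σb
    with sum>0⇒∃ (b ∘ S) (subst (0 <_) (sym Σb) z<s) | sum>0⇒∃ (a ∘ S) (subst (0 <_) (sym Σa) z<s)
  ... | u , bu>0 | v , av>0 =
    let au≡0 , bu≡1 = leaf _ _ (d≤1 u) bu>0 in
    dag-by-addArc S au≡0 bu≡1 av>0 Σa Σb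
      (inj₂ λ j → ≤-trans (+-mono-≤ (m∸n≤m _ (δ v j)) (m∸n≤m _ (δ u j))) (d≤1 j))
    where
    leaf : ∀ x y → x + y ≤ 1 → y > 0 → x ≡ 0 × y ≡ 1
    leaf zero    1 _ _ = refl , refl
    leaf zero    (suc (suc _)) (s≤s ()) _
    leaf (suc x) (suc y) (s≤s le) _ = contradiction (n≤0⇒n≡0 le) (m+1+n≢0 x)

  -- If the only vertices with a > 0 are leaves themselves, attach one of these
  -- to w instead of attaching u.
  dag-by-source-leaf : (S : Sequence n) {u w : Fin n} → a (S u) ≡ 0 → b (S u) ≡ 1 →
                       2 ≤ degree (S w) → sum (a ∘ S) ≡ suc m → sum (b ∘ S) ≡ suc m →
                       suc m < #nonzero S → IsDagSequence S
  dag-by-source-leaf S {u} {w} au≡0 bu≡1 2≤dw Σa Σb m<N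
    with sum>0⇒∃ (a ∘ S) (subst (0 <_) (sym Σa) z<s)
  ... | v , av>0 with 2 ≤? degree (S v)
  ...   | yes 2≤dv = dag-by-leaf S au≡0 bu≡1 av>0 2≤dv Σa Σb m<N
  ...   | no  2≰dv with 0 <? a (S w)
  ...     | yes aw>0 = dag-by-leaf S au≡0 bu≡1 aw>0 2≤dw Σa Σb m<N
  ...     | no  aw≯0 =
    let bv≡0 , av≡1 = leaf _ _ (s≤s⁻¹ (≰⇒> 2≰dv)) av>0
    in swap-dag (dag-by-leaf (swap S) bv≡0 av≡1 bw>0
         (subst (2 ≤_) (+-comm (a (S w)) _) 2≤dw) Σb Σa (subst (suc m <_) (#nonzero-swap S) m<N))
    where
    leaf : ∀ x y → x + y ≤ 1 → x > 0 → y ≡ 0 × x ≡ 1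
    leaf 1 zero _ _ = refl , refl
    leaf (suc (suc x)) y (s≤s ()) _
    leaf 1 (suc y) (s≤s ()) _

    bw>0 : b (S w) > 0
    bw>0 = <⇒≤ (subst (λ x → 2 ≤ x + b (S w)) (n≤0⇒n≡0 (≮⇒≥ aw≯0)) 2≤dw)

-- Induction on the number of arcs: a leaf is split off while some degree is at least 2, and an edge
-- of a matching otherwise.
sparse⇒dag : ∀ m (S : Sequence n) → Sparse m S → IsDagSequence S
sparse⇒dag {n} zero S (Σa , Σb , _) = (λ _ _ → false) , acyclic , λ v →
    trans (sum-replicate-zero n) (sym (sum≡0⇒≡0 (a ∘ S) Σa v))
  , trans (sum-replicate-zero n) (sym (sum≡0⇒≡0 (b ∘ S) Σb v))
  where
  acyclic : Acyclic {n} (λ _ _ → false)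
  acyclic v (() ∷ _)
sparse⇒dag (suc m) S (Σa , Σb , inj₂ d≤1) = dag-by-matching (sparse⇒dag m) S d≤1 Σa Σb
sparse⇒dag (suc m) S (Σa , Σb , inj₁ m<N) with any? (λ j → 2 ≤? degree (S j))
... | no  none =
  dag-by-matching (sparse⇒dag m) S (λ j → s≤s⁻¹ (≰⇒> λ 2≤d → none (j , 2≤d))) Σa Σb
... | yes (w , 2≤dw) with ∃-degree-1 S Σa Σb m<N
...   | u , du≡1 with a (S u) in au | b (S u) in bu
...     | zero  | _ = dag-by-source-leaf (sparse⇒dag m) S au (trans bu du≡1) 2≤dw Σa Σb m<N
-- The only arc at `u` is incoming; reversal makes `u` a source leaf.
...     | suc x | y = swap-dag (dag-by-source-leaf (sparse⇒dag m) (swap S)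
  (trans bu (m+n≡0⇒n≡0 x (suc-injective du≡1)))
  (trans au (cong suc (m+n≡0⇒m≡0 x (suc-injective du≡1))))
  (subst (2 ≤_) (+-comm (a (S w)) _) 2≤dw) Σb Σa
  (subst (suc m <_) (#nonzero-swap S) m<N))

-- Sparsity of `S` and of `reduce S i`

theorem2 : ∀ (n k : ℕ) (S : Sequence n) → CanonicallySorted S
    → (∀ j → ¬ IsZero (S j))
    → sum (λ j → a (S j)) ≡ sum (λ j → b (S j))
    → sum (λ j → a (S j)) ≤ n ∸ 1
    → #sources S ≡ k → k > 0
    → ¬ IsSourceSinkSequence S
    → (i : Fin n) → IsStream (S i) → a (S i) ≤ k
    → IsDagSequence S ⇔ IsDagSequence (reduce S i)
theorem2 (suc n) k S sorted ¬zero Σa≡Σb Σa≤n refl k>0 _ i (ai>0 , bi>0) ai≤k =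
  mk⇔ (const S′-dag) (const S-dag)
  where
  S′ = reduce S i
  Σa = sum (a ∘ S)

  initial : Fin (suc n) → ℕ
  initial j = ⟦ does (toℕ j <? a (S i)) ⟧

  -- The block of the first `a (S i)` positions fits, since `a (S i) ≤ k ≤ suc n`.
  Σinitial : sum initial ≡ a (S i)
  Σinitial = #-initial (≤-trans ai≤k (#≤n (does ∘ isSource? ∘ S)))

  S-nonzero : ∀ j → nonzero (S j) ≡ 1
  S-nonzero j = nonzero≡1 {S j} (n≢0⇒n>0 λ d≡0 →
    ¬zero j (m+n≡0⇒m≡0 (a (S j)) d≡0 , m+n≡0⇒n≡0 (a (S j)) d≡0))

  S-dag : IsDagSequence S
  S-dag = sparse⇒dag Σa S (refl , sym Σa≡Σb ,
    inj₁ (subst (Σa <_) (sym (trans (sum-cong-≗ S-nonzero) (sum-const-1 (suc n)))) (s≤s Σa≤n)))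

  a′ : ∀ j → a (S′ j) + δ i j * a (S i) ≡ a (S j)
  a′ j with j Fin.≟ i
  ... | yes refl = +-identityʳ _
  ... | no  _    = +-identityʳ _

  -- Positions below `a (S i) ≤ k` hold source tuples, whose positive `b` makes the truncated
  -- subtraction exact.
  b′ : ∀ j → b (S′ j) + initial j ≡ b (S j)
  b′ j = lemma (toℕ j <? a (S i))
    where
    lemma : (d : Dec (toℕ j < a (S i))) →
            (if does d then b (S j) ∸ 1 else b (S j)) + ⟦ does d ⟧ ≡ b (S j)
    lemma (yes j<ai) =
      m∸n+n≡m (proj₂ (CanonicallySorted.sources-first sorted j (<-≤-trans j<ai ai≤k)))
    lemma (no _) = +-identityʳ _

  Σa′ : sum (a ∘ S′) + a (S i) ≡ Σa
  Σa′ = trans (cong (sum (a ∘ S′) +_) (sym (sum-δ* i (a (S i)))))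
    (trans (sym (∑-distrib-+ (a ∘ S′) (λ j → δ i j * a (S i)))) (sum-cong-≗ a′))

  Σb′ : sum (b ∘ S′) + a (S i) ≡ sum (b ∘ S)
  Σb′ = trans (cong (sum (b ∘ S′) +_) (sym Σinitial))
    (trans (sym (∑-distrib-+ (b ∘ S′) initial)) (sum-cong-≗ b′))

  -- Only a tuple of the initial block can become zero, and there `initial` compensates; outside it,
  -- the tuple at `i` keeps `b (S i) > 0`.
  nonzero′ : ∀ j → 1 ≤ nonzero (S′ j) + initial j
  nonzero′ j = lemma (j Fin.≟ i) (toℕ j <? a (S i))
    where
    lemma : (d : Dec (j ≡ i)) (e : Dec (toℕ j < a (S i))) →
            1 ≤ 1 ⊓ ((if does d then 0 else a (S j)) + (if does e then b (S j) ∸ 1 else b (S j)))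
                + ⟦ does e ⟧
    lemma _          (yes _) = m≤n+m 1 _
    lemma (yes refl) (no _)  =
      ≤-reflexive (sym (trans (+-identityʳ _) (nonzero≡1 {⟨ 0 , b (S i) ⟩} bi>0)))
    lemma (no _)     (no _)  = ≤-reflexive (sym (trans (+-identityʳ _) (S-nonzero j)))

  #nonzero′ : suc n ≤ #nonzero S′ + a (S i)
  #nonzero′ = subst₂ _≤_ (sum-const-1 (suc n))
    (trans (∑-distrib-+ (nonzero ∘ S′) initial) (cong (#nonzero S′ +_) Σinitial))
    (sum-mono-≤ nonzero′)

  S′-dag : IsDagSequence S′
  S′-dag = sparse⇒dag (sum (a ∘ S′)) S′ (refl ,
    +-cancelʳ-≡ (a (S i)) _ _ (trans Σb′ (trans (sym Σa≡Σb) (sym Σa′))) ,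
    -- With `a (S i)` added to both sides, the claim follows from `Σa < suc n` and `#nonzero′`.
    inj₁ (+-cancelʳ-< (a (S i)) _ _
      (≤-trans (s≤s (subst (_≤ n) (sym Σa′) Σa≤n)) #nonzero′)))
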